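{- For any non-negative integers $n$ and $t$ and any $\mathbf{x}\in\{0,1\}^n$, $$\#\mathrm{iS}^{(t)}_{BA}(\mathbf{x})=\binom{n+2t}{t}.$$
   Context: A balanced adjacent insertion (BAI) inserts the two-bit word $01$ or $10$, as consecutive bits, at some position of a bit sequence (including the beginning and the end): $x_1\cdots x_n\mapsto x_1\cdots x_i\,b\bar b\,x_{i+1}\cdots x_n$ with $0\le i\le n$, $b\in\{0,1\}$, $\bar b=1-b$. $\mathrm{iS}_{BA}(\mathbf{x})$ is the set of all sequences obtained from $\mathbf{x}$ by a single BAI. Put $\mathrm{iS}^{(0)}_{BA}(\mathbf{x}):=\{\mathbf{x}\}$ and $\mathrm{iS}^{(t)}_{BA}(\mathbf{x}):=\bigcup_{\mathbf{y}\in\mathrm{iS}^{(t-1)}_{BA}(\mathbf{x})}\mathrm{iS}_{BA}(\mathbf{y})$ for $t\ge1$. -}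

module Defs where

open import Level using (Level; 0ℓ; _⊔_)
open import Data.Bool.Base using (Bool; not)
open import Data.List.Base using (List; _∷_; _++_; length; take; drop)
open import Data.List.Relation.Unary.Unique.Propositional using (Unique)
import Data.List.Membership.Propositional as List
open import Data.Nat.Base using (ℕ; zero; suc; _≤_)
open import Data.Product.Base using (Σ-syntax; ∃-syntax; _×_)
open import Function.Bundles using (_⇔_)
open import Relation.Binary.PropositionalEquality using (_≡_)
open import Relation.Unary using (Pred; _∈_; ｛_｝)

-- Bits are Booleans (so b̄ is not b); sets of bit sequences are predicates.
BitSeq : Set
BitSeq = List Bool

insertBA : ℕ → Bool → BitSeq → BitSeq
insertBA i b x = take i x ++ b ∷ not b ∷ drop i x

iS : BitSeq → Pred BitSeq 0ℓ
iS x y = ∃[ i ] ∃[ b ] (i ≤ length x × y ≡ insertBA i b x)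

iS^ : ℕ → BitSeq → Pred BitSeq 0ℓ
iS^ zero    x   = ｛ x ｝
iS^ (suc t) x z = ∃[ y ] (y ∈ iS^ t x × z ∈ iS y)

-- Cardinality is that of a duplicate-free enumeration, rather than of the
-- type Σ A P, which would count the different membership proofs (e.g. different
-- insertion positions yielding the same sequence) separately.
infix 4 #_≡_
#_≡_ : {a ℓ : Level} {A : Set a} → Pred A ℓ → ℕ → Set (a ⊔ ℓ)
#_≡_ {A = A} P k =
  Σ[ xs ∈ List A ] (Unique xs × (∀ y → (y List.∈ xs) ⇔ (y ∈ P)) × length xs ≡ k)

{-# OPTIONS --safe #-}

-- Call x a stack of pending bits and read y from left to right: a bit equal to
-- the top pops it, while a bit opposite to the top b must later be cancelled by
-- a b, so it pushes another b (on the empty stack, reading c pushes not c).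
-- The sequences of iS^ t x are those y that empty the stack with exactly t
-- pushes.  As this reading is deterministic, the number N n t of such y, with
-- n the length of x, satisfies N (1 + n) (1 + t) = N n (1 + t) + N (2 + n) t
-- and N 0 (1 + t) = 2 N 1 t, which are Pascal's rule for (n + 2 t) C t.
module Submission where

open import Defs
open import Data.Bool.Base using (Bool; true; false; not)
open import Data.Bool.Properties using (not-involutive)
open import Data.List.Base using (List; []; _∷_; _++_; length; map)
open import Data.List.Membership.Propositional.Properties
  using (∈-map⁺; ∈-map⁻; ∈-++⁺ˡ; ∈-++⁺ʳ; ∈-++⁻)
open import Data.List.Properties using (length-map; length-++; ∷-injectiveˡ; ∷-injectiveʳ)
open import Data.List.Relation.Unary.All using ([])
open import Data.List.Relation.Unary.AllPairs using ([]; _∷_)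
open import Data.List.Relation.Unary.Any using (here)
open import Data.List.Relation.Unary.Unique.Propositional using (Unique)
open import Data.List.Relation.Unary.Unique.Propositional.Properties using (map⁺; ++⁺)
import Data.List.Membership.Propositional as List
open import Data.Nat.Base using (ℕ; zero; suc; _+_; _*_; _∸_; z≤n; s≤s)
open import Data.Nat.Combinatorics using (_C_; nCk≡nC[n∸k]; nCk+nC[k+1]≡[n+1]C[k+1])
open import Data.Nat.Properties using (+-comm; +-suc; +-identityʳ; m≤n+m; m+n∸n≡m)
open import Data.Nat.Tactic.RingSolver using (solve-∀)
open import Data.Product.Base using (_,_)
open import Data.Sum.Base using (inj₁; inj₂)
open import Function.Base using (_∘_)
open import Function.Bundles using (mk⇔)
open import Relation.Binary.PropositionalEquality
  using (_≡_; _≢_; refl; sym; trans; cong; cong₂; subst; module ≡-Reasoning)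
open import Relation.Unary using (_∈_)

private
  variable
    b c : Bool
    t : ℕ
    x y z : BitSeq

data Reads : ℕ → BitSeq → BitSeq → Set where
  done  : Reads 0 [] []
  pop   : Reads t x y → Reads t (b ∷ x) (b ∷ y)
  start : Reads t (b ∷ []) y → Reads (suc t) [] (not b ∷ y)
  push  : Reads t (b ∷ b ∷ x) y → Reads (suc t) (b ∷ x) (not b ∷ y)

-- The recursion is on y: the derivations returned by cancel are not subterms.
mutual
  -- Where the longer stack pops `b`, the shorter one pushes `not b`, which restores the very stack
  -- that the pop exposed; this is the one extra push. The prefix `u` keeps track of pushes made
  -- above the pair.
  cancel : ∀ u {b} → Reads t (u ++ b ∷ not b ∷ x) y → Reads (suc t) (u ++ x) y
  cancel []      {b} (pop {y = y} r) =
    subst (λ a → Reads _ _ (a ∷ y)) (not-involutive b) (pushAny r)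
  -- The push buries the pair under a new `b`. Cancelling there leaves `b ∷ x`, the stack wanted
  -- after `not b` is read over `x`.
  cancel []      (push {b = b} r) = pushAny (cancel (b ∷ []) r)
  cancel (a ∷ u) (pop r)          = pop (cancel u r)
  cancel (a ∷ u) (push r)         = push (cancel (a ∷ a ∷ u) r)

  -- If `not b` is already on top of `x`, reading it must pop instead. The stack `b ∷ x` then starts
  -- with an opposite pair, and `cancel` removes it for the same price of one push.
  pushAny : Reads t (b ∷ x) y → Reads (suc t) x (not b ∷ y)
  pushAny {x = []} r = start r
  pushAny {b = true}  {x = true ∷ _} r = push r
  pushAny {b = true}  {x = false ∷ _} r = pop (cancel [] r)
  pushAny {b = false} {x = true ∷ _} r = pop (cancel [] r)
  pushAny {b = false} {x = false ∷ _} r = push r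

reads-prepend : ∀ b → Reads t x y → Reads (suc t) x (b ∷ not b ∷ y)
reads-prepend b r = subst (λ a → Reads _ _ (a ∷ not b ∷ _)) (not-involutive b) (pushAny (pop r))

-- Bits before position `i` are read as before, and an inserted pair costs one push over whatever
-- stack it meets.
reads-insertBA : ∀ i b → Reads t x y → Reads (suc t) x (insertBA i b y)
reads-insertBA zero    b r         = reads-prepend b r
-- `take` and `drop` saturate, so a position past the end means the end.
reads-insertBA (suc i) b done      = reads-prepend b done
reads-insertBA (suc i) b (pop r)   = pop (reads-insertBA i b r)
reads-insertBA (suc i) b (start r) = start (reads-insertBA i b r)
reads-insertBA (suc i) b (push r)  = push (reads-insertBA i b r)

reads-refl : ∀ x → Reads 0 x x
reads-refl []      = done
reads-refl (_ ∷ x) = pop (reads-refl x)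

reads-zero : Reads 0 x y → y ≡ x
reads-zero done    = refl
reads-zero (pop r) = cong (_ ∷_) (reads-zero r)

iS^⇒reads : ∀ t → y ∈ iS^ t x → Reads t x y
iS^⇒reads zero    refl                       = reads-refl _
iS^⇒reads (suc t) (_ , p , i , b , _ , refl) = reads-insertBA i b (iS^⇒reads t p)

iS-∷ : ∀ c → y ∈ iS x → c ∷ y ∈ iS (c ∷ x)
iS-∷ c (i , b , i≤ , y≡) = suc i , b , s≤s i≤ , cong (c ∷_) y≡

iS^-∷ : ∀ t c → y ∈ iS^ t x → c ∷ y ∈ iS^ t (c ∷ x)
iS^-∷ zero    c refl        = refl
iS^-∷ (suc t) c (z , p , q) = c ∷ z , iS^-∷ t c p , iS-∷ c q

-- `iS^` peels off the last insertion, whereas the first push of a reading stands for the first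
-- insertion.
iS-iS^ : ∀ t → z ∈ iS x → y ∈ iS^ t z → y ∈ iS^ (suc t) x
iS-iS^ zero    q refl        = _ , refl , q
iS-iS^ (suc t) q (w , p , r) = w , iS-iS^ t q p , r

-- First insert `not b`, `b` in front of `x`; the other `t` insertions all take place behind the
-- leading `not b`.
iS^-push : ∀ t → y ∈ iS^ t (b ∷ x) → not b ∷ y ∈ iS^ (suc t) x
iS^-push {b = b} {x = x} t p =
  iS-iS^ t (0 , not b , z≤n , cong (λ a → not b ∷ a ∷ x) (sym (not-involutive b)))
    (iS^-∷ t (not b) p)

reads⇒iS^ : Reads t x y → y ∈ iS^ t x
reads⇒iS^ done                = refl
reads⇒iS^ (pop {t = t} r)     = iS^-∷ t _ (reads⇒iS^ r)
reads⇒iS^ (start {t = t} r)   = iS^-push t (reads⇒iS^ r)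
reads⇒iS^ (push {t = t} r)    = iS^-push t (reads⇒iS^ r)

-- The recursion is lexicographic: a pop shortens the stack, and a push may lengthen it because `t`
-- drops.
enum : ℕ → BitSeq → List BitSeq
enum zero    x       = x ∷ []
enum (suc t) []      = map (true ∷_) (enum t (false ∷ [])) ++ map (false ∷_) (enum t (true ∷ []))
enum (suc t) (b ∷ x) = map (b ∷_) (enum (suc t) x) ++ map (not b ∷_) (enum t (b ∷ b ∷ x))

∈-enum⁺ : Reads t x y → y List.∈ enum t x
∈-enum⁺ {zero}  r                 = here (reads-zero r)
∈-enum⁺ {suc t} (pop r)           = ∈-++⁺ˡ (∈-map⁺ _ (∈-enum⁺ r))
∈-enum⁺ {suc t} (start {b = false} r) = ∈-++⁺ˡ (∈-map⁺ _ (∈-enum⁺ r))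
∈-enum⁺ {suc t} (start {b = true}  r) =
  ∈-++⁺ʳ (map (true ∷_) (enum t (false ∷ []))) (∈-map⁺ _ (∈-enum⁺ r))
∈-enum⁺ {suc t} (push {b = b} {x = x} r) =
  ∈-++⁺ʳ (map (b ∷_) (enum (suc t) x)) (∈-map⁺ _ (∈-enum⁺ r))

∈-enum⁻ : ∀ t x → y List.∈ enum t x → Reads t x y
∈-enum⁻ zero    x  (here refl) = reads-refl x
∈-enum⁻ (suc t) [] p with ∈-++⁻ (map (true ∷_) (enum t (false ∷ []))) p
... | inj₁ q with _ , r , refl ← ∈-map⁻ (true ∷_) q  = start (∈-enum⁻ t _ r)
... | inj₂ q with _ , r , refl ← ∈-map⁻ (false ∷_) q = start (∈-enum⁻ t _ r)
∈-enum⁻ (suc t) (b ∷ x) p with ∈-++⁻ (map (b ∷_) (enum (suc t) x)) p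
... | inj₁ q with _ , r , refl ← ∈-map⁻ (b ∷_) q     = pop (∈-enum⁻ (suc t) x r)
... | inj₂ q with _ , r , refl ← ∈-map⁻ (not b ∷_) q = push (∈-enum⁻ t _ r)

b≢not-b : b ≢ not b
b≢not-b {true}  ()
b≢not-b {false} ()

unique-branch : ∀ {xs ys} → b ≢ c → Unique xs → Unique ys →
                Unique (map (b ∷_) xs ++ map (c ∷_) ys)
unique-branch {b} {c} b≢c xs! ys! =
  ++⁺ (map⁺ ∷-injectiveʳ xs!) (map⁺ ∷-injectiveʳ ys!) λ (p , q) →
    let _ , _ , v≡b∷ = ∈-map⁻ (b ∷_) p
        _ , _ , v≡c∷ = ∈-map⁻ (c ∷_) q
    in b≢c (∷-injectiveˡ (trans (sym v≡b∷) v≡c∷))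

enum-unique : ∀ t x → Unique (enum t x)
enum-unique zero    x       = [] ∷ []
enum-unique (suc t) []      = unique-branch b≢not-b (enum-unique t _) (enum-unique t _)
enum-unique (suc t) (b ∷ x) = unique-branch b≢not-b (enum-unique (suc t) x) (enum-unique t _)

length-branch : ∀ xs ys → length (map (b ∷_) xs ++ map (c ∷_) ys) ≡ length xs + length ys
length-branch {b} {c} xs ys = trans (length-++ (map (b ∷_) xs))
  (cong₂ _+_ (length-map (b ∷_) xs) (length-map (c ∷_) ys))

-- The two middle entries of an odd row agree by symmetry, so the doubled count over the empty stack
-- becomes a Pascal sum.
[1+2t]Ct≡[1+2t]C[1+t] : ∀ t → (1 + 2 * t) C t ≡ (1 + 2 * t) C (1 + t)
[1+2t]Ct≡[1+2t]C[1+t] t = begin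
  (1 + 2 * t) C t               ≡⟨ cong (_C t) eq ⟩
  (1 + t + t) C t               ≡⟨ nCk≡nC[n∸k] (m≤n+m t (1 + t)) ⟩
  (1 + t + t) C (1 + t + t ∸ t) ≡⟨ cong ((1 + t + t) C_) (m+n∸n≡m (1 + t) t) ⟩
  (1 + t + t) C (1 + t)         ≡⟨ cong (_C (1 + t)) eq ⟨
  (1 + 2 * t) C (1 + t)         ∎
  where
  open ≡-Reasoning
  eq : 1 + 2 * t ≡ 1 + t + t
  eq = cong (λ m → 1 + (t + m)) (+-identityʳ t)

length-enum : ∀ t x → length (enum t x) ≡ (length x + 2 * t) C t
length-enum zero    x  = refl
length-enum (suc t) [] = begin
  length (enum (suc t) [])                              ≡⟨ length-branch (enum t _) (enum t _) ⟩
  length (enum t (false ∷ [])) + length (enum t (true ∷ []))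
    ≡⟨ cong₂ _+_ (length-enum t _) (length-enum t _) ⟩
  (1 + 2 * t) C t + (1 + 2 * t) C t
    ≡⟨ cong ((1 + 2 * t) C t +_) ([1+2t]Ct≡[1+2t]C[1+t] t) ⟩
  (1 + 2 * t) C t + (1 + 2 * t) C (1 + t)               ≡⟨ nCk+nC[k+1]≡[n+1]C[k+1] (1 + 2 * t) t ⟩
  (2 + 2 * t) C (1 + t)                                 ≡⟨ cong (_C (1 + t)) (cong suc (+-suc t (t + 0))) ⟨
  (2 * (1 + t)) C (1 + t)                               ∎
  where open ≡-Reasoning
length-enum (suc t) (b ∷ x) = begin
  length (enum (suc t) (b ∷ x))                         ≡⟨ length-branch (enum (suc t) x) (enum t _) ⟩
  length (enum (suc t) x) + length (enum t (b ∷ b ∷ x))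
    ≡⟨ cong₂ _+_ (length-enum (suc t) x) (length-enum t _) ⟩
  m C (1 + t) + (2 + length x + 2 * t) C t
    -- The push branch has two more stack bits than the pop branch and one push fewer, so both lie
    -- in row `m`.
    ≡⟨ cong (λ k → m C (1 + t) + k C t) (shift (length x) t) ⟩
  m C (1 + t) + m C t                                   ≡⟨ +-comm (m C (1 + t)) (m C t) ⟩
  m C t + m C (1 + t)                                   ≡⟨ nCk+nC[k+1]≡[n+1]C[k+1] m t ⟩
  (1 + m) C (1 + t)                                     ∎
  where
  open ≡-Reasoning
  m = length x + 2 * (1 + t)
  shift : ∀ n t → 2 + n + 2 * t ≡ n + 2 * (1 + t)
  shift = solve-∀

theorem11p4 : (n t : ℕ) (x : BitSeq) → length x ≡ n →
    # iS^ t x ≡ ((n + 2 * t) C t)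
theorem11p4 n t x refl =
  enum t x , enum-unique t x ,
  (λ y → mk⇔ (reads⇒iS^ ∘ ∈-enum⁻ t x) (∈-enum⁺ ∘ iS^⇒reads t)) ,
  length-enum t x
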